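{- Computability is not stable over the structure $\langle\mathbb{N}\rangle$ (the set of natural numbers with no operations).
   Context: Computability over natural numbers is the usual one. A set $A \subseteq \mathbb{N}$ is effectively enumerable if it is empty or the image of a total computable function from $\mathbb{N}$ to $\mathbb{N}$. For $A \subseteq \mathbb{N}^m$ and $B \subseteq \mathbb{N}$, a computable function from $A$ to $B$ is a partial computable function that is defined at every element of $A$ and takes values in $B$ there. Indexing: an indexing of a set $E$ is a partial function $i$ from $\mathbb{N}$ to $E$ such that $dom(i)$ is effectively enumerable, $i$ is surjective, and there is a computable function $eq$ from $dom(i)\times dom(i)$ to $\{0,1\}$ with $eq(x,y)=1$ if $i(x)=i(y)$ and $eq(x,y)=0$ otherwise. An indexing $i$ of the set $E$ is an admissible indexing of a one-sorted structure $\langle E,op_1,\ldots,op_p\rangle$ if every operation $op: E^m\to E$ among $op_1,\ldots,op_p$ is computable relatively to $i$, that is, there is a computable function $\hat{op}$ from $dom(i)^m$ to $dom(i)$ such that $i(\hat{op}(x_1,\ldots,x_m)) = op(i(x_1),\ldots,i(x_m))$ for all $x_1,\ldots,x_m\in dom(i)$. When there are no operations, every indexing is admissible. Computability is stable over $\langle E,op_1,\ldots,op_p\rangle$ if there exists an admissible indexing of this structure and, for all admissible indexings $j$ and $j'$ of it, there exists a computable function $h$ from $dom(j')$ to $dom(j)$ such that $j' = j\circ h$. -}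

module Defs where

open import Data.Fin using (Fin)
open import Data.List using (List; [])
open import Data.List.Relation.Unary.All using () renaming (All to Allᴸ)
open import Data.Nat using (ℕ; zero; suc; _<_)
open import Data.Product using (Σ; ∃; _×_; _,_)
open import Data.Sum using (_⊎_)
open import Data.Vec using (Vec; []; _∷_; lookup)
open import Data.Vec.Relation.Unary.All using (All)
open import Data.Vec.Relation.Binary.Pointwise.Inductive using (Pointwise)
open import Function.Bundles using (_⇔_)
open import Level using (Level; 0ℓ; _⊔_)
open import Relation.Binary.PropositionalEquality using (_≡_)
open import Relation.Nullary using (¬_)
open import Relation.Unary using (Pred; U; Empty)

private
  variable
    a b : Level
    m n : ℕ

-- The notions below belong to classical mathematics, so existence and
-- disjunction are read classically throughout (negative translation).  Under
-- excluded middle these coincide with ∃ and _⊎_.  With Agda's own ∃, an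
-- indexing would be an Agda function on its domain, and the existence of a
-- non-computable one would contradict Church's thesis.

∃ᶜ : {A : Set a} → (A → Set b) → Set (a ⊔ b)
∃ᶜ P = ¬ ¬ ∃ P

infixr 1 _⊎ᶜ_

_⊎ᶜ_ : Set a → Set b → Set (a ⊔ b)
A ⊎ᶜ B = ¬ ¬ (A ⊎ B)

-- Partial computable functions ℕⁿ ⇀ ℕ are those defined by μ-recursive codes.

data Code : ℕ → Set where
  zeroᶜ : Code n
  sucᶜ  : Code 1
  proj  : Fin n → Code n
  comp  : Code m → Vec (Code n) m → Code n
  prec  : Code n → Code (suc (suc n)) → Code (suc n)
  μ     : Code (suc n) → Code n

infix 4 _[_]⇓_ _[_]⇓*_

mutual

  data _[_]⇓_ : Code n → Vec ℕ n → ℕ → Set where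
    ⇓zero  : {xs : Vec ℕ n} → zeroᶜ [ xs ]⇓ 0
    ⇓suc   : ∀ {x} → sucᶜ [ x ∷ [] ]⇓ suc x
    ⇓proj  : {k : Fin n} {xs : Vec ℕ n} → proj k [ xs ]⇓ lookup xs k
    ⇓comp  : {f : Code m} {gs : Vec (Code n) m} {xs : Vec ℕ n} {ys : Vec ℕ m} {z : ℕ} →
             gs [ xs ]⇓* ys → f [ ys ]⇓ z → comp f gs [ xs ]⇓ z
    ⇓prec₀ : {f : Code n} {g : Code (suc (suc n))} {xs : Vec ℕ n} {y : ℕ} →
             f [ xs ]⇓ y → prec f g [ 0 ∷ xs ]⇓ y
    ⇓precₛ : {f : Code n} {g : Code (suc (suc n))} {xs : Vec ℕ n} {k y z : ℕ} →
             prec f g [ k ∷ xs ]⇓ y → g [ k ∷ y ∷ xs ]⇓ z → prec f g [ suc k ∷ xs ]⇓ z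
    ⇓μ     : {f : Code (suc n)} {xs : Vec ℕ n} {k : ℕ} →
             f [ k ∷ xs ]⇓ 0 →
             (∀ l → l < k → ∃ λ y → f [ l ∷ xs ]⇓ suc y) →
             μ f [ xs ]⇓ k

  data _[_]⇓*_ : Vec (Code n) m → Vec ℕ n → Vec ℕ m → Set where
    []  : {xs : Vec ℕ n} → [] [ xs ]⇓* []
    _∷_ : {f : Code n} {fs : Vec (Code n) m} {xs : Vec ℕ n} {y : ℕ} {ys : Vec ℕ m} →
          f [ xs ]⇓ y → fs [ xs ]⇓* ys → (f ∷ fs) [ xs ]⇓* (y ∷ ys)

-- f is a computable function from A ⊆ ℕᵐ to B ⊆ ℕ; nothing is required of f
-- outside A.

infix 4 _∶_⟶_

_∶_⟶_ : Code m → Pred (Vec ℕ m) 0ℓ → Pred ℕ 0ℓ → Set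
f ∶ A ⟶ B = ∀ xs → A xs → ∃ᶜ λ y → f [ xs ]⇓ y × B y

EffectivelyEnumerable : Pred ℕ 0ℓ → Set
EffectivelyEnumerable A =
  Empty A ⊎ᶜ
  ∃ᶜ λ (f : Code 1) → (f ∶ U ⟶ U) × (∀ y → A y ⇔ ∃ᶜ λ x → f [ x ∷ [] ]⇓ y)

-- Set-theoretic partial functions, given by their graphs.

infix 4 _⇀_

record _⇀_ (A B : Set) : Set₁ where
  field
    graph      : A → B → Set
    functional : ∀ {x y y′} → graph x y → graph x y′ → y ≡ y′

open _⇀_ public

module _ {A B : Set} where

  dom : (A ⇀ B) → Pred A 0ℓ
  dom f x = ∃ᶜ λ y → graph f x y

  -- "f(x) = g(y)", both sides being defined

  SameValue : (A ⇀ B) → A → (A ⇀ B) → A → Set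
  SameValue f x g y = ∃ᶜ λ z → graph f x z × graph g y z

record Indexing (E : Set) : Set₁ where
  field
    index      : ℕ ⇀ E
    enumerable : EffectivelyEnumerable (dom index)
    surjective : ∀ e → ∃ᶜ λ x → graph index x e
    decidable  : ∃ᶜ λ (eq : Code 2) →
      (eq ∶ All (dom index) ⟶ λ v → v ≡ 0 ⊎ v ≡ 1) ×
      (∀ x y v → dom index x → dom index y → eq [ x ∷ y ∷ [] ]⇓ v →
        (SameValue index x index y → v ≡ 1) ×
        (¬ SameValue index x index y → v ≡ 0))

open Indexing public

Operation : Set → Set
Operation E = Σ ℕ λ m → Vec E m → E

record Structure : Set₁ where
  field
    Carrier    : Set
    operations : List (Operation Carrier)

open Structure public

ComputableRelativeTo : {E : Set} → Indexing E → Operation E → Set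
ComputableRelativeTo i (m , op) = ∃ᶜ λ (f : Code m) →
  (f ∶ All (dom (index i)) ⟶ dom (index i)) ×
  (∀ xs es y → Pointwise (graph (index i)) xs es → f [ xs ]⇓ y →
    ¬ ¬ graph (index i) y (op es))

Admissible : (S : Structure) → Indexing (Carrier S) → Set
Admissible S i = Allᴸ (ComputableRelativeTo i) (operations S)

-- "j′ = j ∘ h for some computable h from dom(j′) to dom(j)".  Here j ∘ h is the
-- composite with h as a function on dom(j′), so equality is only required there.

TranslatesTo : {E : Set} → Indexing E → Indexing E → Set
TranslatesTo j′ j = ∃ᶜ λ (h : Code 1) →
  (h ∶ All (dom (index j′)) ⟶ dom (index j)) ×
  (∀ x y → dom (index j′) x → h [ x ∷ [] ]⇓ y → SameValue (index j′) x (index j) y)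

ComputabilityStableOver : Structure → Set₁
ComputabilityStableOver S =
  (∃ᶜ λ i → Admissible S i) ×
  (∀ j j′ → Admissible S j → Admissible S j′ → TranslatesTo j′ j)

⟨ℕ⟩ : Structure
⟨ℕ⟩ = record { Carrier = ℕ ; operations = [] }

{-# OPTIONS --safe #-}

-- Codes are countable, so let ⌜_⌝ number them injectively.  Consider the
-- permutation of ℕ that exchanges 2e and 2e + 1 exactly when e = ⌜ c ⌝ for a code
-- c sending 2e to 2e.  It differs from every code c at 2⌜ c ⌝, hence is not
-- computable.  Being injective, it is an indexing of ℕ whose equality is that of
-- ℕ; a translation of it to the identity indexing would compute it.

module Submission where

open import Defs
open import Data.Fin using (toℕ; zero; suc)
open import Data.Fin.Properties using (toℕ-injective)
open import Data.List.Relation.Unary.All using ([])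
open import Data.Nat using (ℕ; zero; suc; _+_; _∸_; pred; ⌊_/2⌋)
open import Data.Nat.Properties using (_≟_; <-cmp; +-identityʳ; +-suc; n∸n≡0; suc-injective; pred[m∸n]≡m∸[1+n]; m+n≡0⇒m≡0; m+n≡0⇒n≡0; m∸n≡0⇒m≤n; ≤-antisym; n≡⌊n+n/2⌋)
open import Data.Product using (∃; _×_; _,_; proj₁; proj₂)
open import Data.Sum using (_⊎_; inj₁; inj₂)
open import Data.Unit using (tt)
open import Data.Vec using (Vec; []; _∷_)
open import Data.Vec.Relation.Unary.All using ([]; _∷_)
open import Function.Base using (_∘_)
open import Function.Bundles using (mk⇔)
open import Level using (0ℓ)
open import Relation.Binary.Definitions using (tri<; tri≈; tri>)
open import Relation.Binary.PropositionalEquality using (_≡_; _≢_; refl; sym; trans; cong; cong₂; subst)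
open import Relation.Nullary using (¬_; yes; no)
open import Relation.Nullary.Negation using (contradiction)
open import Relation.Unary using (Pred)

private
  variable
    m n : ℕ

-- Evaluation is deterministic

mutual

  ⇓-deterministic : {f : Code n} {xs : Vec ℕ n} {y z : ℕ} →
                    f [ xs ]⇓ y → f [ xs ]⇓ z → y ≡ z
  ⇓-deterministic ⇓zero         ⇓zero         = refl
  ⇓-deterministic ⇓suc          ⇓suc          = refl
  ⇓-deterministic ⇓proj         ⇓proj         = refl
  ⇓-deterministic (⇓comp ps p)  (⇓comp qs q)
    with refl ← ⇓*-deterministic ps qs        = ⇓-deterministic p q
  ⇓-deterministic (⇓prec₀ p)    (⇓prec₀ q)    = ⇓-deterministic p q
  ⇓-deterministic (⇓precₛ p p′) (⇓precₛ q q′)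
    with refl ← ⇓-deterministic p q           = ⇓-deterministic p′ q′
  -- Two distinct results are impossible: at the smaller one, `f` would be zero by its own
  -- evaluation and a successor by the minimality of the larger one.
  ⇓-deterministic (⇓μ {k = k} p below-k) (⇓μ {k = l} q below-l) with <-cmp k l
  ... | tri≈ _ k≡l _ = k≡l
  ... | tri< k<l _ _ with () ← ⇓-deterministic p (proj₂ (below-l k k<l))
  ... | tri> _ _ l<k with () ← ⇓-deterministic (proj₂ (below-k l l<k)) q

  ⇓*-deterministic : {fs : Vec (Code n) m} {xs : Vec ℕ n} {ys zs : Vec ℕ m} →
                     fs [ xs ]⇓* ys → fs [ xs ]⇓* zs → ys ≡ zs
  ⇓*-deterministic []       []       = refl
  ⇓*-deterministic (p ∷ ps) (q ∷ qs) = cong₂ _∷_ (⇓-deterministic p q) (⇓*-deterministic ps qs)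

-- Numbering of codes

-- Walks through ℕ × ℕ one antidiagonal after the other.
next : ℕ × ℕ → ℕ × ℕ
next (a , zero)  = zero , suc a
next (a , suc b) = suc a , b

unpair : ℕ → ℕ × ℕ
unpair zero    = 0 , 0
unpair (suc k) = next (unpair k)

-- Trace the walk backwards: the predecessor of `(suc a , b)` lies on the same antidiagonal, that of
-- `(0 , suc b)` is the end `(b , 0)` of the previous one. The recursion is lexicographic in `s` and
-- `a`.
unpair-reaches : ∀ s a b → a + b ≡ s → ∃ λ k → unpair k ≡ (a , b)
unpair-reaches s       (suc a) b       eq
  with k , p ← unpair-reaches s a (suc b) (trans (+-suc a b) eq) = suc k , cong next p
unpair-reaches s       zero    zero    eq = 0 , refl
unpair-reaches (suc s) zero    (suc b) eq
  with k , p ← unpair-reaches s b zero (trans (+-identityʳ b) (suc-injective eq)) = suc k , cong next p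

abstract

  pair : ℕ → ℕ → ℕ
  pair a b = proj₁ (unpair-reaches (a + b) a b refl)

  unpair-pair : ∀ a b → unpair (pair a b) ≡ (a , b)
  unpair-pair a b = proj₂ (unpair-reaches (a + b) a b refl)

pair-injective : ∀ {a b c d} → pair a b ≡ pair c d → a ≡ c × b ≡ d
pair-injective {a} {b} {c} {d} eq = cong proj₁ ab≡cd , cong proj₂ ab≡cd
  where
  ab≡cd : (a , b) ≡ (c , d)
  ab≡cd = trans (sym (unpair-pair a b)) (trans (cong unpair eq) (unpair-pair c d))

tag : Code n → ℕ
tag zeroᶜ      = 0
tag sucᶜ       = 1
tag (proj _)   = 2
tag (comp _ _) = 3
tag (prec _ _) = 4
tag (μ _)      = 5

mutual

  ⌜_⌝ : Code n → ℕ
  ⌜ c ⌝ = pair (tag c) (body c)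

  body : Code n → ℕ
  body zeroᶜ                = 0
  body sucᶜ                 = 0
  body (proj k)             = toℕ k
  -- The inner arity is recorded so that equal numbers give the components equal types.
  body (comp {m = m} f gs)  = pair m (pair ⌜ f ⌝ ⌜ gs ⌝*)
  body (prec f g)           = pair ⌜ f ⌝ ⌜ g ⌝
  body (μ f)                = ⌜ f ⌝

  ⌜_⌝* : Vec (Code n) m → ℕ
  ⌜ [] ⌝*     = 0
  ⌜ c ∷ cs ⌝* = pair ⌜ c ⌝ ⌜ cs ⌝*

mutual

  ⌜⌝-injective : {c d : Code n} → ⌜ c ⌝ ≡ ⌜ d ⌝ → c ≡ d
  ⌜⌝-injective {c = c} {d} eq with t , b ← pair-injective eq = tag-body-injective c d t b

  tag-body-injective : (c d : Code n) → tag c ≡ tag d → body c ≡ body d → c ≡ d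
  tag-body-injective zeroᶜ      zeroᶜ        refl b = refl
  tag-body-injective sucᶜ       sucᶜ         refl b = refl
  tag-body-injective (proj k)   (proj l)     refl b = cong proj (toℕ-injective b)
  tag-body-injective (comp f gs) (comp f′ gs′) refl b
    with refl , b′ ← pair-injective b
    with p , q ← pair-injective b′ = cong₂ comp (⌜⌝-injective p) (⌜⌝*-injective q)
  tag-body-injective (prec f g) (prec f′ g′) refl b
    with p , q ← pair-injective b = cong₂ prec (⌜⌝-injective p) (⌜⌝-injective q)
  tag-body-injective (μ f)      (μ f′)       refl b = cong μ (⌜⌝-injective b)

  ⌜⌝*-injective : {cs ds : Vec (Code n) m} → ⌜ cs ⌝* ≡ ⌜ ds ⌝* → cs ≡ ds
  ⌜⌝*-injective {cs = []}     {[]}     eq = refl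
  ⌜⌝*-injective {cs = c ∷ cs} {d ∷ ds} eq
    with p , q ← pair-injective eq = cong₂ _∷_ (⌜⌝-injective p) (⌜⌝*-injective q)

-- Equality of natural numbers is computable

predᶜ : Code 1
predᶜ = prec zeroᶜ (proj zero)

⇓pred : ∀ x → predᶜ [ x ∷ [] ]⇓ pred x
⇓pred zero    = ⇓prec₀ ⇓zero
⇓pred (suc x) = ⇓precₛ (⇓pred x) ⇓proj

-- The subtrahend comes first, as it is the recursion argument.
monusᶜ : Code 2
monusᶜ = prec (proj zero) (comp predᶜ (proj (suc zero) ∷ []))

⇓monus : ∀ y x → monusᶜ [ y ∷ x ∷ [] ]⇓ x ∸ y
⇓monus zero    x = ⇓prec₀ ⇓proj
⇓monus (suc y) x = subst (monusᶜ [ suc y ∷ x ∷ [] ]⇓_) (pred[m∸n]≡m∸[1+n] x y)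
  (⇓precₛ (⇓monus y x) (⇓comp (⇓proj ∷ []) (⇓pred (x ∸ y))))

plusᶜ : Code 2
plusᶜ = prec (proj zero) (comp sucᶜ (proj (suc zero) ∷ []))

⇓plus : ∀ x y → plusᶜ [ x ∷ y ∷ [] ]⇓ x + y
⇓plus zero    y = ⇓prec₀ ⇓proj
⇓plus (suc x) y = ⇓precₛ (⇓plus x y) (⇓comp (⇓proj ∷ []) ⇓suc)

isZero : ℕ → ℕ
isZero zero    = 1
isZero (suc _) = 0

isZeroᶜ : Code 1
isZeroᶜ = prec (comp sucᶜ (zeroᶜ ∷ [])) zeroᶜ

⇓isZero : ∀ x → isZeroᶜ [ x ∷ [] ]⇓ isZero x
⇓isZero zero    = ⇓prec₀ (⇓comp (⇓zero ∷ []) ⇓suc)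
⇓isZero (suc x) = ⇓precₛ (⇓isZero x) ⇓zero

-- Tests whether the sum of both truncated differences, which is the distance of the arguments,
-- vanishes.
equalᶜ : Code 2
equalᶜ = comp isZeroᶜ (comp plusᶜ (monusᶜ ∷ comp monusᶜ (proj (suc zero) ∷ proj zero ∷ []) ∷ []) ∷ [])

⇓equal : ∀ x y → equalᶜ [ x ∷ y ∷ [] ]⇓ isZero ((y ∸ x) + (x ∸ y))
⇓equal x y = ⇓comp
  (⇓comp (⇓monus x y ∷ ⇓comp (⇓proj ∷ ⇓proj ∷ []) (⇓monus y x) ∷ []) (⇓plus (y ∸ x) (x ∸ y)) ∷ [])
  (⇓isZero _)

isZero-01 : ∀ x → isZero x ≡ 0 ⊎ isZero x ≡ 1
isZero-01 zero    = inj₂ refl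
isZero-01 (suc _) = inj₁ refl

isZero-≢0 : ∀ {x} → x ≢ 0 → isZero x ≡ 0
isZero-≢0 {zero}  x≢0 = contradiction refl x≢0
isZero-≢0 {suc _} _   = refl

distance-refl : ∀ x → (x ∸ x) + (x ∸ x) ≡ 0
distance-refl x = cong₂ _+_ (n∸n≡0 x) (n∸n≡0 x)

distance≡0⇒≡ : ∀ x y → (y ∸ x) + (x ∸ y) ≡ 0 → x ≡ y
distance≡0⇒≡ x y eq = ≤-antisym
  (m∸n≡0⇒m≤n (m+n≡0⇒n≡0 (y ∸ x) eq)) (m∸n≡0⇒m≤n (m+n≡0⇒m≡0 (y ∸ x) eq))

-- Bijections ℕ → E are indexings of E

module _ {E : Set} (f : ℕ ⇀ E)
         (injective : ∀ {x x′ e} → graph f x e → graph f x′ e → x ≡ x′)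
         (total : ∀ x → dom f x)
         (onto : ∀ e → ∃ᶜ λ x → graph f x e) where

  private
    -- The doubly negated conclusion suffices, since equality on ℕ is decided by `_≟_` where this is
    -- used.
    sameValue⇒≡ : ∀ {x y} → SameValue f x f y → ¬ ¬ x ≡ y
    sameValue⇒≡ same x≢y = same λ { (_ , p , q) → x≢y (injective p q) }

    ≡⇒sameValue : ∀ x → SameValue f x f x
    ≡⇒sameValue x k = total x λ { (e , p) → k (e , p , p) }

    equal-correct : ∀ x y v → equalᶜ [ x ∷ y ∷ [] ]⇓ v →
                    (SameValue f x f y → v ≡ 1) × (¬ SameValue f x f y → v ≡ 0)
    equal-correct x y v ev with refl ← ⇓-deterministic ev (⇓equal x y) with x ≟ y
    ... | yes refl = (λ _ → cong isZero (distance-refl x)) , λ ¬same → contradiction (≡⇒sameValue x) ¬same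
    ... | no x≢y   = (λ same → contradiction x≢y (sameValue⇒≡ same)) , λ _ → isZero-≢0 (x≢y ∘ distance≡0⇒≡ x y)

  bijection⇒indexing : Indexing E
  bijection⇒indexing = record
    { index      = f
    -- The domain is all of ℕ, so the identity `proj zero` enumerates it.
    ; enumerable = λ k → k (inj₂ λ k′ → k′
        ( proj zero
        , (λ { (x ∷ []) _ k″ → k″ (x , ⇓proj , tt) })
        , λ y → mk⇔ (λ _ k″ → k″ (y , ⇓proj)) (λ _ → total y)))
    ; surjective = onto
    ; decidable  = λ k → k
        ( equalᶜ
        , (λ { (x ∷ y ∷ []) _ k′ → k′ (_ , ⇓equal x y , isZero-01 _) })
        , λ x y v _ _ → equal-correct x y v)
    }

identity : ℕ ⇀ ℕ
identity = record { graph = _≡_ ; functional = λ p q → trans (sym p) q }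

identityIndexing : Indexing ℕ
identityIndexing = bijection⇒indexing identity
  (λ p q → trans p (sym q)) (λ x k → k (x , refl)) (λ x k → k (x , refl))

-- Exchanging 2e and 2e + 1 on a set of blocks

swap : ℕ → ℕ
swap 0             = 1
swap 1             = 0
swap (suc (suc x)) = suc (suc (swap x))

swap-involutive : ∀ x → swap (swap x) ≡ x
swap-involutive 0             = refl
swap-involutive 1             = refl
swap-involutive (suc (suc x)) = cong (2 +_) (swap-involutive x)

swap-≢ : ∀ x → swap x ≢ x
swap-≢ (suc (suc x)) eq = swap-≢ x (suc-injective (suc-injective eq))

⌊swap/2⌋ : ∀ x → ⌊ swap x /2⌋ ≡ ⌊ x /2⌋
⌊swap/2⌋ 0             = refl
⌊swap/2⌋ 1             = refl
⌊swap/2⌋ (suc (suc x)) = cong suc (⌊swap/2⌋ x)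

module SwapOn (P : Pred ℕ 0ℓ) where

  -- A graph instead of a function, because `P` need not be decidable; `⌊ x /2⌋` is the number of
  -- the block containing `x`.
  Swapped : ℕ → ℕ → Set
  Swapped x y = (P ⌊ x /2⌋ × swap x ≡ y) ⊎ (¬ P ⌊ x /2⌋ × x ≡ y)

  swapped-functional : ∀ {x y y′} → Swapped x y → Swapped x y′ → y ≡ y′
  swapped-functional (inj₁ (_ , refl))  (inj₁ (_ , refl))  = refl
  swapped-functional (inj₁ (px , _))    (inj₂ (¬px , _))   = contradiction px ¬px
  swapped-functional (inj₂ (¬px , _))   (inj₁ (px , _))    = contradiction px ¬px
  swapped-functional (inj₂ (_ , refl))  (inj₂ (_ , refl))  = refl

  -- Swapping stays within a block and is an involution. Symmetry turns functionality into
  -- injectivity and totality into surjectivity.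
  swapped-sym : ∀ {x y} → Swapped x y → Swapped y x
  swapped-sym {x} (inj₁ (px , refl)) = inj₁ (subst P (sym (⌊swap/2⌋ x)) px , swap-involutive x)
  swapped-sym (inj₂ (¬px , refl))    = inj₂ (¬px , refl)

  -- Excluded middle under double negation: if `swap x` is refuted as a value, then `P` fails at the
  -- block of `x`, and `x` itself is the value.
  swapped-total : ∀ x → ∃ᶜ λ y → Swapped x y
  swapped-total x k = k (x , inj₂ ((λ px → k (swap x , inj₁ (px , refl))) , refl))

  swapping : ℕ ⇀ ℕ
  swapping = record { graph = Swapped ; functional = swapped-functional }

  swappingIndexing : Indexing ℕ
  swappingIndexing = bijection⇒indexing swapping
    (λ p q → swapped-functional (swapped-sym p) (swapped-sym q))
    swapped-total
    (λ y k → swapped-total y λ { (x , p) → k (x , swapped-sym p) })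

Diagonal : Pred ℕ 0ℓ
Diagonal e = ∃ λ (c : Code 1) → ⌜ c ⌝ ≡ e × c [ e + e ∷ [] ]⇓ e + e

open SwapOn Diagonal

swapped-noncomputable : (h : Code 1) {y : ℕ} → let x = ⌜ h ⌝ + ⌜ h ⌝ in
                        h [ x ∷ [] ]⇓ y → ¬ Swapped x y
swapped-noncomputable h {y} ev sw with ⌜ h ⌝ in eq
-- The block of `e + e` is `e`, so `sw` decides by `Diagonal e`.
... | e rewrite sym (n≡⌊n+n/2⌋ e) with sw
... | inj₂ (¬diag , refl)              = ¬diag (h , eq , ev)
-- Injectivity of the numbering identifies `c` with `h`, which would then yield both `swap (e + e)`
-- and `e + e`.
... | inj₁ ((c , eq′ , ev′) , refl) with refl ← ⌜⌝-injective (trans eq′ (sym eq))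
  = swap-≢ (e + e) (⇓-deterministic ev ev′)

proposition8 : ¬ ComputabilityStableOver ⟨ℕ⟩
proposition8 (_ , translate) =
  -- Admissibility is `[]` on both sides, there being no operations. The goal is absurdity, so
  -- classical existentials can be opened.
  translate identityIndexing swappingIndexing [] [] λ { (h , h-maps , h-correct) →
    let x = ⌜ h ⌝ + ⌜ h ⌝ in
    h-maps (x ∷ []) (swapped-total x ∷ []) λ { (y , ev , _) →
      h-correct x y (swapped-total x) ev λ { (_ , sw , refl) →
        swapped-noncomputable h ev sw } } }
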